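{- Let $\langle G',{\cal P},{\cal F}\rangle$ be an instance of Module Matching in which $v_1$ is pendant in $G'$ with unique neighbour $v_2$, such that $E(H_i)=F_i$ for every $i$, and such that all vertices of $M_1$ are matched by $F_1$. Let $G=G'({\cal P})$, let $\langle G^*,{\cal P}^*,{\cal F}^*\rangle$ be the reduced instance obtained by removing $v_1$ from $G'$ and adding virtual split edges to $H_2$, let $F^*$ be a maximum-cardinality matching of $G^*({\cal P}^*)$, and let $F$ be the matching of $G$ constructed from $F^*$ by the post-processing, all as described in the context. Then $F$ is a maximum-cardinality matching of $G$.
   Context: All graphs are finite and simple. An instance $\langle G',{\cal P},{\cal F}\rangle$ of Module Matching consists of a graph $G'$ with vertices $v_1,\dots,v_p$, a collection of graphs ${\cal P}=\{H_1,\dots,H_p\}$, and a collection ${\cal F}=\{F_1,\dots,F_p\}$ with $F_i$ a maximum matching of $H_i$. The substitution graph $G=G'({\cal P})$ is obtained by replacing every vertex $v_i$ with a module inducing $H_i$: $V(G)$ is the disjoint union of the sets $M_i=V(H_i)$, $G[M_i]=H_i$, and for $i\neq j$ every vertex of $M_i$ is adjacent to every vertex of $M_j$ if $v_iv_j\in E(G')$, and to none otherwise. The vertex $v_1$ is pendant if it has exactly one neighbour in $G'$. Virtual split edges. Starting from $F_2^*=F_2$ and $H_2^*=H_2$: while there exist two distinct vertices $x_2,y_2\in M_2$ left exposed by the current $F_2^*$ and an edge $\{x_1,y_1\}\in F_1$ not yet used as a label, add to both $H_2^*$ and $F_2^*$ a virtual edge $\{x_2,y_2\}$ labeled by $\{x_1,y_1\}$.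 (A vertex is exposed by a matching if it is incident to none of its edges.) Set $G^*=G'\setminus v_1$, ${\cal P}^*=\{H_2^*\}\cup({\cal P}\setminus\{H_1,H_2\})$, ${\cal F}^*=\{F_2^*\}\cup({\cal F}\setminus\{F_1,F_2\})$. Post-processing. From a maximum-cardinality matching $F^*$ of $G^*({\cal P}^*)$, construct $F$ as follows. (1) Put in $F$ all non-virtual edges of $F^*$. (2) For every virtual edge $\{x_2,y_2\}$ with label $\{x_1,y_1\}\in F_1$: if $\{x_2,y_2\}\in F^*$ then add $\{x_1,y_2\},\{x_2,y_1\}$ to $F$; otherwise add $\{x_1,y_1\}$ to $F$. (3) Add to $F$ all edges of $F_1$ that do not label any virtual edge. -}

module Defs where

open import Data.Nat.Base using (ℕ; suc; _+_; _≤_)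
open import Data.Fin.Base using (Fin; zero; suc)
import Data.Fin.Properties as Fin
open import Data.Empty using (⊥-elim)
open import Data.Bool.Base using (if_then_else_)
open import Data.List.Base using (List; []; _∷_; _++_; length; map; filter; concatMap)
open import Data.List.Relation.Unary.Any as Any using (Any; any?)
open import Data.List.Relation.Unary.All using (All)
open import Data.List.Relation.Unary.AllPairs using (AllPairs)
open import Data.Product.Base using (Σ; _×_; _,_; proj₁; proj₂)
import Data.Product.Properties as Product
open import Data.Sum.Base using (_⊎_; inj₁; inj₂)
open import Relation.Nullary.Decidable using (yes; no; does; map′; ¬?; _×-dec_; _⊎-dec_)
open import Relation.Nullary.Negation using (¬_)
open import Relation.Unary using () renaming (Decidable to Decidable₁)
open import Relation.Binary.Definitions
  using (Symmetric; Irreflexive; Decidable; DecidableEquality)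
open import Relation.Binary.PropositionalEquality using (_≡_; _≢_; refl; ≢-sym)

-- Finiteness lives in the vertex type: it is always Fin n or a finite
-- disjoint union of such types.
record SimpleGraph (V : Set) : Set₁ where
  field
    Adj    : V → V → Set
    symm   : Symmetric Adj
    irrefl : Irreflexive _≡_ Adj
    adj?   : Decidable Adj

open SimpleGraph public

-- Ordered representative of an unordered pair {x , y}.
Edge : Set → Set
Edge V = V × V

module _ {V : Set} where

  infix 4 _≈ₑ_ _∈ₑ_ _∉ₑ_

  _≈ₑ_ : Edge V → Edge V → Set
  (a , b) ≈ₑ (c , d) = (a ≡ c × b ≡ d) ⊎ (a ≡ d × b ≡ c)

  _∈ₑ_ : Edge V → List (Edge V) → Set
  e ∈ₑ M = Any (e ≈ₑ_) M

  _∉ₑ_ : Edge V → List (Edge V) → Set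
  e ∉ₑ M = ¬ (e ∈ₑ M)

  Incident : V → Edge V → Set
  Incident x (a , b) = x ≡ a ⊎ x ≡ b

  Matched : List (Edge V) → V → Set
  Matched M x = Any (Incident x) M

  Exposed : List (Edge V) → V → Set
  Exposed M x = ¬ Matched M x

  IsEdge : SimpleGraph V → Edge V → Set
  IsEdge G (x , y) = Adj G x y

  Disjoint : Edge V → Edge V → Set
  Disjoint e f = ∀ x → Incident x e → ¬ Incident x f

  -- AllPairs compares entries at different positions, so a matching never
  -- lists an edge twice and its cardinality is its length.
  IsMatching : SimpleGraph V → List (Edge V) → Set
  IsMatching G M = All (IsEdge G) M × AllPairs Disjoint M

  IsMaximumMatching : SimpleGraph V → List (Edge V) → Set
  IsMaximumMatching G M =
    IsMatching G M × (∀ M′ → IsMatching G M′ → length M′ ≤ length M)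

  UniqueNeighbour : SimpleGraph V → V → V → Set
  UniqueNeighbour G v w = Adj G v w × (∀ u → Adj G v u → u ≡ w)

  module EdgeDec (_≟_ : DecidableEquality V) where

    _≈ₑ?_ : Decidable _≈ₑ_
    (a , b) ≈ₑ? (c , d) = (a ≟ c ×-dec b ≟ d) ⊎-dec (a ≟ d ×-dec b ≟ c)

    _∈ₑ?_ : Decidable _∈ₑ_
    e ∈ₑ? M = any? (e ≈ₑ?_) M

    -- The conjunct x ≢ y only discards degenerate pairs (x , x) from es.
    addEdges : SimpleGraph V → List (Edge V) → SimpleGraph V
    addEdges G es = record
      { Adj    = λ x y → Adj G x y ⊎ (x ≢ y × (x , y) ∈ₑ es)
      ; symm   = λ where
          (inj₁ xy)         → inj₁ (symm G xy)
          (inj₂ (x≢y , xy)) → inj₂ (≢-sym x≢y , Any-swap xy)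
      ; irrefl = λ where
          x≡y (inj₁ xy)        → irrefl G x≡y xy
          x≡y (inj₂ (x≢y , _)) → x≢y x≡y
      ; adj?   = λ x y → adj? G x y ⊎-dec (¬? (x ≟ y) ×-dec (x , y) ∈ₑ? es)
      }
      where
      swap≈ : ∀ {x y} {e : Edge V} → (x , y) ≈ₑ e → (y , x) ≈ₑ e
      swap≈ (inj₁ (p , q)) = inj₂ (q , p)
      swap≈ (inj₂ (p , q)) = inj₁ (q , p)

      Any-swap : ∀ {x y} {M : List (Edge V)} → (x , y) ∈ₑ M → (y , x) ∈ₑ M
      Any-swap = Any.map swap≈

deleteFirst : ∀ {n} → SimpleGraph (Fin (suc n)) → SimpleGraph (Fin n)
deleteFirst G = record
  { Adj    = λ i j → Adj G (suc i) (suc j)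
  ; symm   = symm G
  ; irrefl = λ where refl → irrefl G refl
  ; adj?   = λ i j → adj? G (suc i) (suc j)
  }

module Substitution {p : ℕ} (G′ : SimpleGraph (Fin p))
                    {size : Fin p → ℕ} (H : ∀ i → SimpleGraph (Fin (size i))) where

  Vertex : Set
  Vertex = Σ (Fin p) λ i → Fin (size i)

  -- In `across`, i ≢ j follows from irreflexivity of G′.
  data SubstAdj : Vertex → Vertex → Set where
    inside : ∀ {i x y}   → Adj (H i) x y → SubstAdj (i , x) (i , y)
    across : ∀ {i j x y} → Adj G′ i j    → SubstAdj (i , x) (j , y)

  substitution : SimpleGraph Vertex
  substitution = record
    { Adj = SubstAdj ; symm = symm′ ; irrefl = irrefl′ ; adj? = adj′? }
    where
    symm′ : Symmetric SubstAdj
    symm′ (inside xy) = inside (symm (H _) xy)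
    symm′ (across ij) = across (symm G′ ij)

    irrefl′ : Irreflexive _≡_ SubstAdj
    irrefl′ refl (inside xx) = irrefl (H _) refl xx
    irrefl′ refl (across ii) = irrefl G′ refl ii

    adj′? : Decidable SubstAdj
    adj′? (i , x) (j , y) with i Fin.≟ j
    ... | yes refl = map′ inside
                          (λ where (inside xy) → xy
                                   (across ii) → ⊥-elim (irrefl G′ refl ii))
                          (adj? (H i) x y)
    ... | no i≢j = map′ across
                        (λ where (inside _)  → ⊥-elim (i≢j refl)
                                 (across ij) → ij)
                        (adj? G′ i j)

open Substitution public using (substitution)

-- The data ⟨G′, 𝒫, ℱ⟩; the module indexed by i has vertex set Fin (size i).
record Triple (p : ℕ) : Set₁ where
  field
    G′   : SimpleGraph (Fin p)
    size : Fin p → ℕ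
    H    : ∀ i → SimpleGraph (Fin (size i))
    F    : ∀ i → List (Edge (Fin (size i)))

  Vertex : Set
  Vertex = Σ (Fin p) λ i → Fin (size i)

  _≟ᵥ_ : DecidableEquality Vertex
  _≟ᵥ_ = Product.≡-dec Fin._≟_ Fin._≟_

  G : SimpleGraph Vertex
  G = substitution G′ H

IsModuleMatching : ∀ {p} → Triple p → Set
IsModuleMatching I = ∀ i → IsMaximumMatching (Triple.H I i) (Triple.F I i)

-- Reduction of an instance whose first two vertices are v₁ = zero, v₂ = suc zero.
module Split {n : ℕ} (I : Triple (2 + n)) where

  open Triple I

  M₁ M₂ : Set
  M₁ = Fin (size zero)
  M₂ = Fin (size (suc zero))

  F₁ : List (Edge M₁)
  F₁ = F zero

  -- A virtual edge {x₂ , y₂} together with its label {x₁ , y₁}.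
  Labelled : Set
  Labelled = Edge M₂ × Edge M₁

  F₂* : List Labelled → List (Edge M₂)
  F₂* L = map proj₁ L ++ F (suc zero)

  H₂* : List Labelled → SimpleGraph M₂
  H₂* L = EdgeDec.addEdges Fin._≟_ (H (suc zero)) (map proj₁ L)

  Addable : List Labelled → Labelled → Set
  Addable L ((x₂ , y₂) , l) =
    x₂ ≢ y₂ × Exposed (F₂* L) x₂ × Exposed (F₂* L) y₂ × l ∈ₑ F₁ × l ∉ₑ map proj₂ L

  -- States the while loop can reach; the choices in each round are arbitrary.
  data Reachable : List Labelled → Set where
    start : Reachable []
    add   : ∀ {L s} → Reachable L → Addable L s → Reachable (s ∷ L)

  IsVirtualSplit : List Labelled → Set
  IsVirtualSplit L = Reachable L × (∀ s → ¬ Addable L s)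

  reduced : List Labelled → Triple (suc n)
  reduced L = record
    { G′   = deleteFirst G′
    ; size = λ i → size (suc i)
    ; H    = λ where
        zero    → H₂* L
        (suc i) → H (suc (suc i))
    ; F    = λ where
        zero    → F₂* L
        (suc i) → F (suc (suc i))
    }

  module _ (L : List Labelled) where

    open Triple (reduced L) using () renaming (Vertex to Vertex*; _≟ᵥ_ to _≟*_)

    embed : Vertex* → Vertex
    embed (i , x) = suc i , x

    embedEdge : Edge Vertex* → Edge Vertex
    embedEdge (u , v) = embed u , embed v

    inM₁ : M₁ → Vertex
    inM₁ x = zero , x

    inM₂ : M₂ → Vertex
    inM₂ x = suc zero , x

    virtualEdge : Labelled → Edge Vertex*
    virtualEdge ((x₂ , y₂) , _) = (zero , x₂) , (zero , y₂)

    virtual? : Decidable₁ (_∈ₑ map virtualEdge L)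
    virtual? e = EdgeDec._∈ₑ?_ _≟*_ e (map virtualEdge L)

    label? : Decidable₁ (_∈ₑ map proj₂ L)
    label? e = EdgeDec._∈ₑ?_ Fin._≟_ e (map proj₂ L)

    unsplit : List (Edge Vertex*) → Labelled → List (Edge Vertex)
    unsplit F* s@((x₂ , y₂) , (x₁ , y₁)) =
      if does (EdgeDec._∈ₑ?_ _≟*_ (virtualEdge s) F*)
      then (inM₁ x₁ , inM₂ y₂) ∷ (inM₂ x₂ , inM₁ y₁) ∷ []
      else (inM₁ x₁ , inM₁ y₁) ∷ []

    postProcess : List (Edge Vertex*) → List (Edge Vertex)
    postProcess F* =
         map embedEdge (filter (λ e → ¬? (virtual? e)) F*)
      ++ concatMap (unsplit F*) L
      ++ map (λ (x , y) → inM₁ x , inM₁ y) (filter (λ e → ¬? (label? e)) F₁)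

-- Write f = |F₁|. Counting gives |F| ≥ f + |F*|, since each virtual edge in F* becomes two
-- edges and each other label is kept. Conversely, let N be a matching of G. Delete its edges
-- inside M₁ ∪ M₂ and between M₁ and M₂, and rematch M₂: the vertices of M₂ are twins seen from
-- outside, so the c edges of N leaving M₂ can be moved to vertices exposed by F₂*, and to
-- ends of edges of F₂* once those run out, while the other p edges of F₂* are added. If M₂
-- has (up to parity) no spare vertex, counting ends of N in M₁ and in M₂ gives |N| ≤ f + |N*|;
-- otherwise no edge of F₂* is lost and |F₂*| = |F₂| + f already pays for the deleted edges.

module Submission where

open import Defs
open Substitution using (inside; across)
open import Data.Nat.Base using (ℕ; zero; suc; _+_; _≤_; z≤n; s≤s; s≤s⁻¹)
import Data.Nat.Properties as ℕ
open import Data.Nat.Tactic.RingSolver using (solve-∀)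
open import Data.Fin.Base using (Fin; zero; suc)
import Data.Fin.Properties as Fin
open import Data.Empty using (⊥-elim)
open import Data.List.Base using (List; []; _∷_; _++_; length; map; filter; concatMap; allFin)
import Data.List.Properties as List
open import Data.List.Membership.Propositional using (_∈_; find)
open import Data.List.Membership.Propositional.Properties using (∈-filter⁺; ∈-filter⁻; ∈-allFin)
open import Data.List.Relation.Unary.Any as Any using (Any; here; there; any?)
import Data.List.Relation.Unary.Any.Properties as Any
open import Data.List.Relation.Unary.All as All using (All; []; _∷_)
import Data.List.Relation.Unary.All.Properties as All
open import Data.List.Relation.Unary.AllPairs as AllPairs using (AllPairs; []; _∷_)
import Data.List.Relation.Unary.AllPairs.Properties as AllPairs
open import Data.List.Relation.Unary.Unique.Propositional using (Unique)
import Data.List.Relation.Unary.Unique.Propositional.Properties as Unique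
open import Data.List.Relation.Binary.Sublist.Propositional
  using (_⊆_; []; _∷_; _∷ʳ_; ⊆-refl)
open import Data.List.Relation.Binary.Sublist.Propositional.Properties using (All-resp-⊆)
open import Data.Product.Base using (∃; _×_; _,_; proj₁; proj₂)
open import Data.Sum.Base using (_⊎_; inj₁; inj₂; [_,_]′)
open import Function.Base using (_∘_; _on_)
open import Function.Bundles using (_⇔_)
open import Relation.Nullary.Decidable using (yes; no; ¬?; _⊎-dec_; decidable-stable)
open import Relation.Nullary.Negation using (¬_)
open import Relation.Unary using (Decidable)
open import Relation.Binary.PropositionalEquality
  using (_≡_; _≢_; refl; sym; trans; cong; cong₂; subst)

-- Counting tools for lists.

suc+suc : ∀ k c → suc k + suc k + c ≡ 2 + (k + k + c)
suc+suc = solve-∀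

-- If n < m then 2n + 2 ≤ 2m, so between even numbers a slack of one is harmless. This absorbs the
-- one vertex of M₂ that the count of ends may leave over.
half-≤ : ∀ m n → m + m ≤ suc (n + n) → m ≤ n
half-≤ m n 2m≤ with m ℕ.≤? n
... | yes m≤n = m≤n
... | no m≰n  = ⊥-elim (ℕ.<⇒≱ (subst (_≤ m + m) (cong suc (ℕ.+-suc n n)) (ℕ.+-mono-≤ n<m n<m)) 2m≤)
  where n<m = ℕ.≰⇒> m≰n

module _ {A : Set} {P Q : A → Set} where

  removeAt-Any : ∀ {xs} (i : Any P xs) → (∀ x → P x → ¬ Q x) → Any Q xs → Any Q (xs Any.─ i)
  removeAt-Any (here p)  ¬PQ (here q)  = ⊥-elim (¬PQ _ p q)
  removeAt-Any (here p)  ¬PQ (there j) = j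
  removeAt-Any (there i) ¬PQ (here q)  = here q
  removeAt-Any (there i) ¬PQ (there j) = there (removeAt-Any i ¬PQ j)

module _ {A B : Set} {R : A → B → Set} where

  -- No entry of `ys` is related to two of the `xs`, so deleting the entry found for the first `x`
  -- leaves a witness for each later one. `R` is a general relation because edges are compared only
  -- up to orientation.
  pigeonhole : ∀ {xs ys} → AllPairs (λ x x′ → ∀ y → R x y → ¬ R x′ y) xs →
               All (λ x → Any (R x) ys) xs → length xs ≤ length ys
  pigeonhole                    []         []       = z≤n
  pigeonhole {x ∷ xs} {ys = ys} (x# ∷ xs#) (i ∷ is) =
    subst (suc (length xs) ≤_) (sym (List.length-removeAt′ ys (Any.index i)))
      (s≤s (pigeonhole xs# (All.zipWith (λ (x#x′ , j) → removeAt-Any i x#x′ j) (x# , is))))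

Unique-length-≤ : ∀ {A : Set} {xs ys : List A} → Unique xs → (∀ x → x ∈ xs → x ∈ ys) →
                  length xs ≤ length ys
Unique-length-≤ xs! xs⊆ys =
  pigeonhole (AllPairs.map (λ x≢x′ y p q → x≢x′ (trans p (sym q))) xs!) (All.tabulate (xs⊆ys _))

module _ {A : Set} {R : A → A → Set} where

  AllPairs-resp-⊆ : ∀ {xs ys} → xs ⊆ ys → AllPairs R ys → AllPairs R xs
  AllPairs-resp-⊆ []         []       = []
  AllPairs-resp-⊆ (_ ∷ʳ τ)   (_ ∷ rs) = AllPairs-resp-⊆ τ rs
  AllPairs-resp-⊆ (refl ∷ τ) (r ∷ rs) = All-resp-⊆ τ r ∷ AllPairs-resp-⊆ τ rs

  AllPairs-++⁻ˡ : ∀ xs {ys} → AllPairs R (xs ++ ys) → AllPairs R xs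
  AllPairs-++⁻ˡ []       _        = []
  AllPairs-++⁻ˡ (x ∷ xs) (r ∷ rs) = All.++⁻ˡ xs r ∷ AllPairs-++⁻ˡ xs rs

  AllPairs-++-cross : ∀ xs {ys x y} → AllPairs R (xs ++ ys) → x ∈ xs → y ∈ ys → R x y
  AllPairs-++-cross (x ∷ xs) (r ∷ rs) (here refl) y∈ = All.lookup (All.++⁻ʳ xs r) y∈
  AllPairs-++-cross (x ∷ xs) (r ∷ rs) (there x∈)  y∈ = AllPairs-++-cross xs rs x∈ y∈

  -- Equal positions give equal entries; different positions give `R` in one of the two orders, and
  -- symmetry gives the other. For a matching: two members are equal or disjoint.
  AllPairs-lookup : (∀ {x y} → R x y → R y x) → ∀ {xs x y} → AllPairs R xs →
                    x ∈ xs → y ∈ xs → x ≡ y ⊎ R x y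
  AllPairs-lookup sy (_ ∷ _)  (here refl) (here refl) = inj₁ refl
  AllPairs-lookup sy (r ∷ _)  (here refl) (there j)   = inj₂ (All.lookup r j)
  AllPairs-lookup sy (r ∷ _)  (there i)   (here refl) = inj₂ (sy (All.lookup r i))
  AllPairs-lookup sy (_ ∷ rs) (there i)   (there j)   = AllPairs-lookup sy rs i j

  concatMap-AllPairs : ∀ {B : Set} {S : B → B → Set} (f : B → List A) →
    (∀ b c → S b c → ∀ x y → x ∈ f b → y ∈ f c → R x y) →
    ∀ {bs} → All (AllPairs R ∘ f) bs → AllPairs S bs → AllPairs R (concatMap f bs)
  concatMap-AllPairs f S⇒R within apart = AllPairs.concat⁺ (All.map⁺ within)
    (AllPairs.map⁺ (AllPairs.map
      (λ s → All.tabulate λ x∈ → All.tabulate λ y∈ → S⇒R _ _ s _ _ x∈ y∈) apart))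

module _ {A : Set} {P : A → Set} (P? : Decidable P) where

  length-filter-¬ : ∀ xs → length (filter (¬? ∘ P?) xs) + length (filter P? xs) ≡ length xs
  length-filter-¬ []       = refl
  length-filter-¬ (x ∷ xs) with P? x
  ... | yes _ = trans (ℕ.+-suc _ _) (cong suc (length-filter-¬ xs))
  ... | no _  = cong suc (length-filter-¬ xs)

-- Unordered edges, their endpoints, and the allocation of vertices.

module _ {V : Set} where

  endpoints : Edge V → List V
  endpoints (x , y) = x ∷ y ∷ []

  endpointsOf : List (Edge V) → List V
  endpointsOf = concatMap endpoints

  ∈-endpoints⁻ : ∀ {x} (e : Edge V) → x ∈ endpoints e → Incident x e
  ∈-endpoints⁻ e (here p)         = inj₁ p
  ∈-endpoints⁻ e (there (here p)) = inj₂ p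

  ∈-endpoints⁺ : ∀ {x} (e : Edge V) → Incident x e → x ∈ endpoints e
  ∈-endpoints⁺ e (inj₁ p) = here p
  ∈-endpoints⁺ e (inj₂ p) = there (here p)

  ∈-endpointsOf⁺ : ∀ {x M} → Matched M x → x ∈ endpointsOf M
  ∈-endpointsOf⁺ = Any.concatMap⁺ endpoints ∘ Any.map (∈-endpoints⁺ _)

  ∈-endpointsOf⁻ : ∀ {x} M → x ∈ endpointsOf M → Matched M x
  ∈-endpointsOf⁻ M = Any.map (∈-endpoints⁻ _) ∘ Any.concatMap⁻ endpoints

  length-endpointsOf : ∀ M → length (endpointsOf M) ≡ length M + length M
  length-endpointsOf []      = refl
  length-endpointsOf (e ∷ M) = cong suc (trans (cong suc (length-endpointsOf M)) (sym (ℕ.+-suc _ _)))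

  ≈ₑ-Incident : ∀ {e f : Edge V} → e ≈ₑ f → ∀ {x} → Incident x e → Incident x f
  ≈ₑ-Incident (inj₁ (refl , refl)) i        = i
  ≈ₑ-Incident (inj₂ (refl , refl)) (inj₁ p) = inj₂ p
  ≈ₑ-Incident (inj₂ (refl , refl)) (inj₂ p) = inj₁ p

  ≈ₑ-refl : ∀ {e : Edge V} → e ≈ₑ e
  ≈ₑ-refl = inj₁ (refl , refl)

  ≈ₑ-sym : ∀ {e f : Edge V} → e ≈ₑ f → f ≈ₑ e
  ≈ₑ-sym (inj₁ (refl , refl)) = inj₁ (refl , refl)
  ≈ₑ-sym (inj₂ (refl , refl)) = inj₂ (refl , refl)

  ≈ₑ-trans : ∀ {e f g : Edge V} → e ≈ₑ f → f ≈ₑ g → e ≈ₑ g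
  ≈ₑ-trans (inj₁ (refl , refl)) q                    = q
  ≈ₑ-trans (inj₂ (refl , refl)) (inj₁ (refl , refl)) = inj₂ (refl , refl)
  ≈ₑ-trans (inj₂ (refl , refl)) (inj₂ (refl , refl)) = inj₁ (refl , refl)

  Disjoint-sym : ∀ {e f : Edge V} → Disjoint e f → Disjoint f e
  Disjoint-sym e#f x x∈f x∈e = e#f x x∈e x∈f

  -- Both edges would have the ends of `g`, hence a common end. This is the hypothesis of
  -- `pigeonhole` when a matching is counted against a list of unordered edges.
  Disjoint-≈ₑ : ∀ {e f : Edge V} → Disjoint e f → ∀ g → e ≈ₑ g → ¬ f ≈ₑ g
  Disjoint-≈ₑ e#f g e≈g f≈g =
    e#f _ (inj₁ refl) (≈ₑ-Incident (≈ₑ-sym f≈g) (≈ₑ-Incident e≈g (inj₁ refl)))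

  -- Disjointness separates the ends of different edges; the absence of loops separates the two ends
  -- of a single edge.
  endpointsOf-Unique : ∀ {M : List (Edge V)} → All (λ (x , y) → x ≢ y) M → AllPairs Disjoint M →
                       Unique (endpointsOf M)
  endpointsOf-Unique x≢y = concatMap-AllPairs endpoints
    (λ e f e#f x y x∈e y∈f x≡y →
       e#f x (∈-endpoints⁻ e x∈e) (∈-endpoints⁻ f (subst (_∈ endpoints f) (sym x≡y) y∈f)))
    (All.map (λ p → (p ∷ []) ∷ [] ∷ []) x≢y)

  -- Withdraws c vertices from the isolated vertices es and the matched ones of M,
  -- breaking edges of M only when es is exhausted.
  record Allocation (c : ℕ) (es : List V) (M : List (Edge V)) : Set where
    field
      taken    : List V
      kept     : List (Edge V)
      #taken   : length taken ≡ c
      kept⊆    : kept ⊆ M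
      sublist  : taken ++ endpointsOf kept ⊆ es ++ endpointsOf M
      #kept    : length kept ≡ length M ⊎
                 length es + (length M + length M) ≤ suc (length kept + length kept + c)

  allocate : ∀ c es M → c ≤ length es + (length M + length M) → Allocation c es M
  allocate zero es M _ = record
    { taken = [] ; kept = M ; #taken = refl ; kept⊆ = ⊆-refl
    ; sublist = skip es ; #kept = inj₁ refl }
    where
    skip : ∀ es → endpointsOf M ⊆ es ++ endpointsOf M
    skip []       = ⊆-refl
    skip (e ∷ es) = e ∷ʳ skip es
  allocate (suc c) (e ∷ es) M (s≤s c≤) = record
    { taken = e ∷ taken ; kept = kept ; #taken = cong suc #taken ; kept⊆ = kept⊆
    ; sublist = refl ∷ sublist
    ; #kept = [ inj₁ , (λ le → inj₂ (ℕ.≤-trans (s≤s le)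
                  (ℕ.≤-reflexive (cong suc (sym (ℕ.+-suc _ c)))))) ]′ #kept }
    where open Allocation (allocate c es M c≤)
  allocate (suc zero) [] ((x , y) ∷ M) _ = record
    { taken = x ∷ [] ; kept = M ; #taken = refl ; kept⊆ = _ ∷ʳ ⊆-refl
    ; sublist = refl ∷ (y ∷ʳ ⊆-refl)
    ; #kept = inj₂ (s≤s (ℕ.≤-reflexive (trans (ℕ.+-suc _ _) (ℕ.+-comm 1 _)))) }
  allocate (suc (suc c)) [] ((x , y) ∷ M) (s≤s c≤) = record
    { taken = x ∷ y ∷ taken ; kept = kept ; #taken = cong (2 +_) #taken
    ; kept⊆ = _ ∷ʳ kept⊆ ; sublist = refl ∷ refl ∷ sublist
    ; #kept = inj₂ (bound #kept) }
    where
    m = length M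
    c≤′ : c ≤ m + m
    c≤′ = s≤s⁻¹ (ℕ.≤-trans c≤ (ℕ.≤-reflexive (ℕ.+-suc m m)))
    open Allocation (allocate c [] M c≤′)
    k = length kept
    bound : k ≡ m ⊎ m + m ≤ suc (k + k + c) → suc m + suc m ≤ suc (k + k + suc (suc c))
    bound h = ℕ.≤-trans (s≤s (ℕ.≤-reflexive (ℕ.+-suc m m))) (ℕ.≤-trans (s≤s (s≤s (weaken h)))
      (ℕ.≤-reflexive (cong suc (sym (trans (ℕ.+-suc _ _) (cong suc (ℕ.+-suc _ _)))))))
      where
      -- An edge has just been broken, so the second alternative is the goal; a recursive call that
      -- breaks nothing satisfies the inequality as well.
      weaken : k ≡ m ⊎ m + m ≤ suc (k + k + c) → m + m ≤ suc (k + k + c)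
      weaken (inj₁ p) = subst (λ z → m + m ≤ suc (z + z + c)) (sym p) (ℕ.m≤n⇒m≤1+n (ℕ.m≤m+n _ c))
      weaken (inj₂ q) = q

-- Invariants of the loop that adds virtual split edges.

module _ {n : ℕ} (I : Triple (2 + n)) where

  open Triple I
  open Split I

  module _ (F₂-matching : IsMatching (H (suc zero)) (F (suc zero))) where

    F₂*-no-loops : ∀ {L} → Reachable L → All (λ (x , y) → x ≢ y) (F₂* L)
    F₂*-no-loops start                  =
      All.map (λ {xy x≡y → irrefl (H (suc zero)) x≡y xy}) (proj₁ F₂-matching)
    F₂*-no-loops (add r (x≢y , _))      = x≢y ∷ F₂*-no-loops r

    -- Both ends of a virtual edge are exposed at the moment it is added, so it meets none of the
    -- edges already present.
    F₂*-disjoint : ∀ {L} → Reachable L → AllPairs Disjoint (F₂* L)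
    F₂*-disjoint start                              = proj₂ F₂-matching
    F₂*-disjoint (add {L} r (_ , x-exposed , y-exposed , _)) =
      All.tabulate (λ where
        f∈ z (inj₁ refl) z∈f → x-exposed (Any.map (λ where refl → z∈f) f∈)
        f∈ z (inj₂ refl) z∈f → y-exposed (Any.map (λ where refl → z∈f) f∈))
      ∷ F₂*-disjoint r

    F₂*-matching : ∀ {L} → Reachable L → IsMatching (H₂* L) (F₂* L)
    F₂*-matching {L} r = All.++⁺ virtual (All.map inj₁ (proj₁ F₂-matching)) , F₂*-disjoint r
      where
      virtual : All (IsEdge (H₂* L)) (map proj₁ L)
      virtual = All.tabulate λ e∈ →
        inj₂ (All.lookup (All.++⁻ˡ _ (F₂*-no-loops r)) e∈ , Any.map (λ where refl → ≈ₑ-refl) e∈)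

  labels∈F₁ : ∀ {L} → Reachable L → All (λ s → proj₂ s ∈ₑ F₁) L
  labels∈F₁ start                          = []
  labels∈F₁ (add r (_ , _ , _ , l∈F₁ , _)) = l∈F₁ ∷ labels∈F₁ r

  labels-distinct : ∀ {L} → Reachable L → AllPairs (λ s t → ¬ proj₂ s ≈ₑ proj₂ t) L
  labels-distinct start                           = []
  labels-distinct (add r (_ , _ , _ , _ , l∉L)) =
    All.map⁻ (All.¬Any⇒All¬ _ l∉L) ∷ labels-distinct r

  -- Every label is, up to orientation, a member of the matching `F₁`. Two members are equal or
  -- disjoint, and equality would make the labels the same unordered edge, which the loop forbids.
  labels-disjoint : AllPairs Disjoint F₁ → ∀ {L} → Reachable L → AllPairs (Disjoint on proj₂) L
  labels-disjoint F₁-disjoint r = go (labels∈F₁ r) (labels-distinct r)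
    where
    apart : ∀ {l m} → l ∈ₑ F₁ → m ∈ₑ F₁ → ¬ l ≈ₑ m → Disjoint l m
    apart l∈ m∈ l≉m with find l∈ | find m∈
    ... | f , f∈ , l≈f | g , g∈ , m≈g with AllPairs-lookup Disjoint-sym F₁-disjoint f∈ g∈
    ... | inj₁ refl = ⊥-elim (l≉m (≈ₑ-trans l≈f (≈ₑ-sym m≈g)))
    ... | inj₂ f#g  = λ x x∈l x∈m → f#g x (≈ₑ-Incident l≈f x∈l) (≈ₑ-Incident m≈g x∈m)

    go : ∀ {L} → All (λ s → proj₂ s ∈ₑ F₁) L → AllPairs (λ s t → ¬ proj₂ s ≈ₑ proj₂ t) L →
         AllPairs (Disjoint on proj₂) L
    go []        []        = []
    go (l∈ ∷ ls) (l≉ ∷ ds) = All.zipWith (λ (m∈ , l≉m) → apart l∈ m∈ l≉m) (ls , l≉) ∷ go ls ds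

  exhausted : AllPairs Disjoint F₁ → ∀ {L} → (∀ s → ¬ Addable L s) →
              ∀ {es} → Unique es → All (Exposed (F₂* L)) es → length es ≤ 1 ⊎ length F₁ ≤ length L
  exhausted F₁-disjoint stop {[]}        _ _ = inj₁ z≤n
  exhausted F₁-disjoint stop {_ ∷ []}    _ _ = inj₁ (s≤s z≤n)
  exhausted F₁-disjoint {L} stop {x ∷ y ∷ _} ((x≢y ∷ _) ∷ _) (x-exposed ∷ y-exposed ∷ _) = inj₂
    (subst (length F₁ ≤_) (List.length-map proj₂ L)
      (pigeonhole (AllPairs.map Disjoint-≈ₑ F₁-disjoint) (All.tabulate λ {l} l∈ →
        decidable-stable (EdgeDec._∈ₑ?_ Fin._≟_ l (map proj₂ L)) λ l∉ →
          stop ((x , y) , l)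
            (x≢y , x-exposed , y-exposed , Any.map (λ where refl → ≈ₑ-refl) l∈ , l∉))))

  -- Classification of the edges of a matching of G by their position relative to M₁ and M₂.

  data Kind : Set where
    within₁ : ∀ x y → Adj (H zero) x y → Kind
    bridge  : M₁ → M₂ → Kind
    within₂ : ∀ x y → Adj (H (suc zero)) x y → Kind
    cross   : ∀ (x : M₂) {i : Fin n} (y : Fin (size (suc (suc i)))) →
              Adj G′ (suc zero) (suc (suc i)) → Kind
    outer   : ∀ {i j : Fin n} x y → Adj G (suc (suc i) , x) (suc (suc j) , y) → Kind

  toEdge : Kind → Edge Vertex
  toEdge (within₁ x y _)       = (zero , x) , (zero , y)
  toEdge (bridge x y)          = (zero , x) , (suc zero , y)
  toEdge (within₂ x y _)       = (suc zero , x) , (suc zero , y)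
  toEdge (cross x {i} y _)     = (suc zero , x) , (suc (suc i) , y)
  toEdge (outer {i} {j} x y _) = (suc (suc i) , x) , (suc (suc j) , y)

  ends₁ : Kind → List M₁
  ends₁ (within₁ x y _) = x ∷ y ∷ []
  ends₁ (bridge x _)    = x ∷ []
  ends₁ _               = []

  ends₂ : Kind → List M₂
  ends₂ (bridge _ y)    = y ∷ []
  ends₂ (within₂ x y _) = x ∷ y ∷ []
  ends₂ (cross x _ _)   = x ∷ []
  ends₂ _               = []

  edges₂ : Kind → List (Edge M₂)
  edges₂ (within₂ x y _) = (x , y) ∷ []
  edges₂ _               = []

  crossings : List Kind → ℕ
  crossings []                = 0
  crossings (cross _ _ _ ∷ K) = suc (crossings K)
  crossings (_ ∷ K)           = crossings K

  ends₁-Incident : ∀ k {x} → x ∈ ends₁ k → Incident (zero , x) (toEdge k)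
  ends₁-Incident (within₁ _ _ _) (here refl)         = inj₁ refl
  ends₁-Incident (within₁ _ _ _) (there (here refl)) = inj₂ refl
  ends₁-Incident (bridge _ _)    (here refl)         = inj₁ refl

  ends₂-Incident : ∀ k {x} → x ∈ ends₂ k → Incident (suc zero , x) (toEdge k)
  ends₂-Incident (bridge _ _)    (here refl)         = inj₂ refl
  ends₂-Incident (within₂ _ _ _) (here refl)         = inj₁ refl
  ends₂-Incident (within₂ _ _ _) (there (here refl)) = inj₂ refl
  ends₂-Incident (cross _ _ _)   (here refl)         = inj₁ refl

  edges₂-Incident : ∀ k {e x} → e ∈ edges₂ k → Incident x e → Incident (suc zero , x) (toEdge k)
  edges₂-Incident (within₂ _ _ _) (here refl) (inj₁ refl) = inj₁ refl
  edges₂-Incident (within₂ _ _ _) (here refl) (inj₂ refl) = inj₂ refl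

  ends₁-Unique : ∀ k → Unique (ends₁ k)
  ends₁-Unique (within₁ _ _ xy)  = ((λ x≡y → irrefl (H zero) x≡y xy) ∷ []) ∷ [] ∷ []
  ends₁-Unique (bridge _ _)      = [] ∷ []
  ends₁-Unique (within₂ _ _ _)   = []
  ends₁-Unique (cross _ _ _)     = []
  ends₁-Unique (outer _ _ _)     = []

  ends₂-Unique : ∀ k → Unique (ends₂ k)
  ends₂-Unique (within₁ _ _ _)   = []
  ends₂-Unique (bridge _ _)      = [] ∷ []
  ends₂-Unique (within₂ _ _ xy)  = ((λ x≡y → irrefl (H (suc zero)) x≡y xy) ∷ []) ∷ [] ∷ []
  ends₂-Unique (cross _ _ _)     = [] ∷ []
  ends₂-Unique (outer _ _ _)     = []

  edges₂-AllPairs : ∀ k → AllPairs Disjoint (edges₂ k)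
  edges₂-AllPairs (within₁ _ _ _) = []
  edges₂-AllPairs (bridge _ _)    = []
  edges₂-AllPairs (within₂ _ _ _) = [] ∷ []
  edges₂-AllPairs (cross _ _ _)   = []
  edges₂-AllPairs (outer _ _ _)   = []

  edges₂-IsEdge : ∀ k → All (IsEdge (H (suc zero))) (edges₂ k)
  edges₂-IsEdge (within₁ _ _ _)  = []
  edges₂-IsEdge (bridge _ _)     = []
  edges₂-IsEdge (within₂ _ _ xy) = xy ∷ []
  edges₂-IsEdge (cross _ _ _)    = []
  edges₂-IsEdge (outer _ _ _)    = []

  unavailable : ∀ {e K z} → All (Disjoint e ∘ toEdge) K → Incident z e →
                ¬ Any (Incident z ∘ toEdge) K
  unavailable ds z∈e any with All.lookupAny ds any
  ... | d , z∈l = d _ z∈e z∈l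

  module _ {K : List Kind} (K-disjoint : AllPairs (Disjoint on toEdge) K) where

    concatMap-ends₁-Unique : Unique (concatMap ends₁ K)
    concatMap-ends₁-Unique = concatMap-AllPairs ends₁
      (λ k l k#l x y x∈ y∈ x≡y → k#l _ (ends₁-Incident k x∈)
         (ends₁-Incident l (subst (_∈ ends₁ l) (sym x≡y) y∈)))
      (All.tabulate λ {k} _ → ends₁-Unique k) K-disjoint

    concatMap-ends₂-Unique : Unique (concatMap ends₂ K)
    concatMap-ends₂-Unique = concatMap-AllPairs ends₂
      (λ k l k#l x y x∈ y∈ x≡y → k#l _ (ends₂-Incident k x∈)
         (ends₂-Incident l (subst (_∈ ends₂ l) (sym x≡y) y∈)))
      (All.tabulate λ {k} _ → ends₂-Unique k) K-disjoint

    -- Lets the maximality of the matching of H₂ bound how many edges of a matching of G lie inside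
    -- M₂.
    concatMap-edges₂-IsMatching : IsMatching (H (suc zero)) (concatMap edges₂ K)
    concatMap-edges₂-IsMatching =
      All.concat⁺ {xss = map edges₂ K} (All.map⁺ (All.tabulate λ {k} _ → edges₂-IsEdge k)) ,
      concatMap-AllPairs edges₂
        (λ k l k#l e f e∈ f∈ x x∈e x∈f →
           k#l _ (edges₂-Incident k e∈ x∈e) (edges₂-Incident l f∈ x∈f))
        (All.tabulate λ {k} _ → edges₂-AllPairs k) K-disjoint

  module _ (pendant : UniqueNeighbour G′ zero (suc zero)) where

    -- Since v₂ is the only neighbour of v₁, no edge runs from M₁ to a module other than M₂, so five
    -- kinds suffice. A kind fixes an orientation (M₁ first, then M₂), hence the agreement only up
    -- to `≈ₑ`.
    classify : ∀ u v → Adj G u v → ∃ λ k → toEdge k ≈ₑ (u , v)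
    classify (zero , x)        (zero , y)        (inside xy) = within₁ x y xy , ≈ₑ-refl
    classify (zero , x)        (zero , y)        (across a)  = ⊥-elim (irrefl G′ refl a)
    classify (zero , x)        (suc zero , y)    _           = bridge x y , ≈ₑ-refl
    classify (zero , x)        (suc (suc j) , y) (across a)
      with () ← proj₂ pendant _ a
    classify (suc zero , x)    (zero , y)        _           = bridge y x , inj₂ (refl , refl)
    classify (suc zero , x)    (suc zero , y)    (inside xy) = within₂ x y xy , ≈ₑ-refl
    classify (suc zero , x)    (suc zero , y)    (across a)  = ⊥-elim (irrefl G′ refl a)
    classify (suc zero , x)    (suc (suc j) , y) (across a)  = cross x y a , ≈ₑ-refl
    classify (suc (suc i) , x) (zero , y)        (across a)
      with () ← proj₂ pendant _ (symm G′ a)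
    classify (suc (suc i) , x) (suc zero , y)    (across a)  =
      cross y x (symm G′ a) , inj₂ (refl , refl)
    classify (suc (suc i) , x) (suc (suc j) , y) a           = outer x y a , ≈ₑ-refl

    classifyAll : ∀ {N} → IsMatching G N →
                  ∃ λ K → length K ≡ length N × AllPairs (Disjoint on toEdge) K
    classifyAll (es , N-disjoint) = kinds es , length-kinds es , kinds-disjoint es N-disjoint
      where
      kinds : ∀ {N} → All (IsEdge G) N → List Kind
      kinds = All.reduce (λ {(u , v)} a → proj₁ (classify u v a))

      length-kinds : ∀ {N} (es : All (IsEdge G) N) → length (kinds es) ≡ length N
      length-kinds []       = refl
      length-kinds (_ ∷ es) = cong suc (length-kinds es)

      kinds-disjoint-from : ∀ {e N} (es : All (IsEdge G) N) → All (Disjoint e) N →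
                            All (Disjoint e ∘ toEdge) (kinds es)
      kinds-disjoint-from []       []         = []
      kinds-disjoint-from (a ∷ es) (e#f ∷ ds) =
        (λ x x∈e x∈f → e#f x x∈e (≈ₑ-Incident (proj₂ (classify _ _ a)) x∈f))
        ∷ kinds-disjoint-from es ds

      kinds-disjoint : ∀ {N} (es : All (IsEdge G) N) → AllPairs Disjoint N →
                       AllPairs (Disjoint on toEdge) (kinds es)
      kinds-disjoint []       []       = []
      kinds-disjoint (a ∷ es) (d ∷ ds) =
        All.map (λ e#k x x∈e → e#k x (≈ₑ-Incident (proj₂ (classify _ _ a)) x∈e))
          (kinds-disjoint-from es d)
        ∷ kinds-disjoint es ds

  -- Rerouting the crossing edges to prescribed vertices of M₂, and counting.

  module _ (L : List Labelled) where

    open Triple (reduced L) using () renaming (Vertex to Vertex*; G to G*)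

    -- All vertices of M₂ have the same neighbours outside M₂, so the M₂-ends of the
    -- crossing edges may be replaced by arbitrary distinct vertices vs of M₂.
    reroute : List Kind → List M₂ → List (Edge Vertex*)
    reroute (cross _ {i} y _ ∷ K)     (v ∷ vs) = ((zero , v) , (suc i , y)) ∷ reroute K vs
    reroute (outer {i} {j} x y _ ∷ K) vs       = ((suc i , x) , (suc j , y)) ∷ reroute K vs
    reroute (_ ∷ K)                   vs       = reroute K vs
    reroute []                        vs       = []

    outer-adj : ∀ {i j x y} → Adj G (suc (suc i) , x) (suc (suc j) , y) →
                Adj G* (suc i , x) (suc j , y)
    outer-adj (inside xy) = inside xy
    outer-adj (across ij) = across ij

    -- Adjacency between different modules depends on the modules alone, so the proof `a` for the
    -- old end in M₂ serves the new end `v` too.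
    reroute-IsEdge : ∀ K vs → All (IsEdge G*) (reroute K vs)
    reroute-IsEdge []                  vs       = []
    reroute-IsEdge (within₁ _ _ _ ∷ K) vs       = reroute-IsEdge K vs
    reroute-IsEdge (bridge _ _ ∷ K)    vs       = reroute-IsEdge K vs
    reroute-IsEdge (within₂ _ _ _ ∷ K) vs       = reroute-IsEdge K vs
    reroute-IsEdge (cross _ _ _ ∷ K)   []       = reroute-IsEdge K []
    reroute-IsEdge (cross _ _ a ∷ K)   (v ∷ vs) = across a ∷ reroute-IsEdge K vs
    reroute-IsEdge (outer _ _ a ∷ K)   vs       = outer-adj a ∷ reroute-IsEdge K vs

    -- The vertices that rerouted edges may cover: inside M₂ only the supplied ones, outside M₂ only
    -- those that `K` covers already.
    Available : List Kind → List M₂ → Vertex* → Set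
    Available K vs (zero  , x) = x ∈ vs
    Available K vs (suc i , x) = Any (Incident (suc (suc i) , x) ∘ toEdge) K

    Available-weaken : ∀ {K vs} k {us} → (∀ {x} → x ∈ vs → x ∈ us) →
                       ∀ z → Available K vs z → Available (k ∷ K) us z
    Available-weaken k vs⊆us (zero  , x) = vs⊆us
    Available-weaken k vs⊆us (suc i , x) = there

    reroute-Available : ∀ K vs {e z} → e ∈ reroute K vs → Incident z e → Available K vs z
    reroute-Available (k@(within₁ _ _ _) ∷ K) vs e∈ z∈e =
      Available-weaken k (λ p → p) _ (reroute-Available K vs e∈ z∈e)
    reroute-Available (k@(bridge _ _) ∷ K)    vs e∈ z∈e =
      Available-weaken k (λ p → p) _ (reroute-Available K vs e∈ z∈e)
    reroute-Available (k@(within₂ _ _ _) ∷ K) vs e∈ z∈e =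
      Available-weaken k (λ p → p) _ (reroute-Available K vs e∈ z∈e)
    reroute-Available (k@(cross _ _ _) ∷ K)   [] e∈ z∈e =
      Available-weaken k (λ p → p) _ (reroute-Available K [] e∈ z∈e)
    reroute-Available (cross _ _ _ ∷ K) (v ∷ vs) (here refl) (inj₁ refl) = here refl
    reroute-Available (cross _ _ _ ∷ K) (v ∷ vs) (here refl) (inj₂ refl) = here (inj₂ refl)
    reroute-Available (k@(cross _ _ _) ∷ K) (v ∷ vs) (there e∈) z∈e =
      Available-weaken k there _ (reroute-Available K vs e∈ z∈e)
    reroute-Available (outer _ _ _ ∷ K) vs (here refl) (inj₁ refl) = here (inj₁ refl)
    reroute-Available (outer _ _ _ ∷ K) vs (here refl) (inj₂ refl) = here (inj₂ refl)
    reroute-Available (k@(outer _ _ _) ∷ K) vs (there e∈) z∈e =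
      Available-weaken k (λ p → p) _ (reroute-Available K vs e∈ z∈e)

    -- The ends outside M₂ are inherited from the disjoint edges of `K`, and each new end in M₂ is
    -- drawn from `vs` once.
    reroute-disjoint : ∀ {K vs} → AllPairs (Disjoint on toEdge) K → Unique vs →
                       AllPairs Disjoint (reroute K vs)
    reroute-disjoint {[]}                  []       vs! = []
    reroute-disjoint {within₁ _ _ _ ∷ K}   (_ ∷ ds) vs! = reroute-disjoint ds vs!
    reroute-disjoint {bridge _ _ ∷ K}      (_ ∷ ds) vs! = reroute-disjoint ds vs!
    reroute-disjoint {within₂ _ _ _ ∷ K}   (_ ∷ ds) vs! = reroute-disjoint ds vs!
    reroute-disjoint {cross _ _ _ ∷ K} {[]} (_ ∷ ds) vs! = reroute-disjoint ds vs!
    reroute-disjoint {cross _ _ _ ∷ K} {v ∷ vs} (d ∷ ds) (v∉vs ∷ vs!) =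
      All.tabulate (λ where
        f∈ _ (inj₁ refl) z∈f → All.lookup v∉vs (reroute-Available K vs f∈ z∈f) refl
        f∈ _ (inj₂ refl) z∈f → unavailable d (inj₂ refl) (reroute-Available K vs f∈ z∈f))
      ∷ reroute-disjoint ds vs!
    reroute-disjoint {outer _ _ _ ∷ K} {vs} (d ∷ ds) vs! =
      All.tabulate (λ where
        f∈ _ (inj₁ refl) z∈f → unavailable d (inj₁ refl) (reroute-Available K vs f∈ z∈f)
        f∈ _ (inj₂ refl) z∈f → unavailable d (inj₂ refl) (reroute-Available K vs f∈ z∈f))
      ∷ reroute-disjoint ds vs!

    -- Double counting of ends. Edges inside M₁ ∪ M₂ pay with their two ends, outer edges with their
    -- two copies on the right. A crossing edge appears there three times, as one end in M₂ and as
    -- two copies, which the extra `crossings K` on the left balances.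
    2*#kinds : ∀ K vs → length vs ≡ crossings K →
      length K + length K + crossings K ≡
        length (concatMap ends₁ K) + length (concatMap ends₂ K)
        + (length (reroute K vs) + length (reroute K vs))
    2*#kinds [] vs _ = refl
    2*#kinds (within₁ _ _ _ ∷ K) vs eq =
      trans (suc+suc (length K) _) (cong (2 +_) (2*#kinds K vs eq))
    2*#kinds (bridge _ _ ∷ K) vs eq =
      trans (suc+suc (length K) _) (trans (cong (2 +_) (2*#kinds K vs eq))
        (right (length (concatMap ends₁ K)) (length (concatMap ends₂ K)) _))
      where
      right : ∀ a b r → 2 + (a + b + r) ≡ suc a + suc b + r
      right = solve-∀
    2*#kinds (within₂ _ _ _ ∷ K) vs eq =
      trans (suc+suc (length K) _) (trans (cong (2 +_) (2*#kinds K vs eq))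
        (right (length (concatMap ends₁ K)) (length (concatMap ends₂ K)) _))
      where
      right : ∀ a b r → 2 + (a + b + r) ≡ a + suc (suc b) + r
      right = solve-∀
    2*#kinds (cross _ _ _ ∷ K) (v ∷ vs) eq =
      trans (suc+suc+suc (length K) _) (trans (cong (3 +_) (2*#kinds K vs (ℕ.suc-injective eq)))
        (right (length (concatMap ends₁ K)) (length (concatMap ends₂ K)) (length (reroute K vs))))
      where
      suc+suc+suc : ∀ k c → suc k + suc k + suc c ≡ 3 + (k + k + c)
      suc+suc+suc = solve-∀
      right : ∀ a b r → 3 + (a + b + (r + r)) ≡ a + suc b + (suc r + suc r)
      right = solve-∀
    2*#kinds (outer _ _ _ ∷ K) vs eq =
      trans (suc+suc (length K) _) (trans (cong (2 +_) (2*#kinds K vs eq))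
        (right (length (concatMap ends₁ K)) (length (concatMap ends₂ K)) (length (reroute K vs))))
      where
      right : ∀ a b r → 2 + (a + b + (r + r)) ≡ a + b + (suc r + suc r)
      right = solve-∀

    -- Each edge is charged once: those meeting M₁ to an end in M₁, those inside M₂ to `edges₂`, all
    -- others to their rerouted copy.
    #kinds≤ : ∀ K vs → length vs ≡ crossings K →
      length K ≤ length (concatMap ends₁ K) + length (concatMap edges₂ K) + length (reroute K vs)
    #kinds≤ []                  vs eq = z≤n
    #kinds≤ (within₁ _ _ _ ∷ K) vs eq = s≤s (ℕ.m≤n⇒m≤1+n (#kinds≤ K vs eq))
    #kinds≤ (bridge _ _ ∷ K)    vs eq = s≤s (#kinds≤ K vs eq)
    #kinds≤ (within₂ _ _ _ ∷ K) vs eq = ℕ.≤-trans (s≤s (#kinds≤ K vs eq))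
      (ℕ.≤-reflexive (cong (_+ length (reroute K vs)) (sym (ℕ.+-suc (length (concatMap ends₁ K)) _))))
    #kinds≤ (cross _ _ _ ∷ K) (v ∷ vs) eq = ℕ.≤-trans (s≤s (#kinds≤ K vs (ℕ.suc-injective eq)))
      (ℕ.≤-reflexive (sym (ℕ.+-suc _ _)))
    #kinds≤ (outer _ _ _ ∷ K)   vs eq = ℕ.≤-trans (s≤s (#kinds≤ K vs eq))
      (ℕ.≤-reflexive (sym (ℕ.+-suc _ _)))

    embed₂ : Edge M₂ → Edge Vertex*
    embed₂ (x , y) = (zero , x) , (zero , y)

    -- The vertices in `taken` and the ends of `kept` form a sublist of a list without repetitions,
    -- so the rerouted edges cannot meet the kept ones inside M₂.
    reroute++kept-IsMatching : ∀ {K es} → AllPairs (Disjoint on toEdge) K →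
      IsMatching (H₂* L) (F₂* L) → Unique (es ++ endpointsOf (F₂* L)) →
      (al : Allocation (crossings K) es (F₂* L)) → let open Allocation al in
      IsMatching G* (reroute K taken ++ map embed₂ kept)
    reroute++kept-IsMatching {K} K-disjoint (F₂*-edges , F₂*-disj) vertices! al =
      All.++⁺ (reroute-IsEdge K taken) (All.map⁺ (All.map inside (All-resp-⊆ kept⊆ F₂*-edges))) ,
      AllPairs.++⁺ (reroute-disjoint K-disjoint (AllPairs-++⁻ˡ taken taken++kept!))
        (AllPairs.map⁺ (AllPairs.map embed₂-disjoint (AllPairs-resp-⊆ kept⊆ F₂*-disj)))
        (All.tabulate λ e∈ → All.map⁺ (All.tabulate λ f∈ → apart e∈ f∈))
      where
      open Allocation al

      taken++kept! : Unique (taken ++ endpointsOf kept)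
      taken++kept! = AllPairs-resp-⊆ sublist vertices!

      embed₂-disjoint : ∀ {e f} → Disjoint e f → Disjoint (embed₂ e) (embed₂ f)
      embed₂-disjoint e#f _ (inj₁ refl) (inj₁ refl) = e#f _ (inj₁ refl) (inj₁ refl)
      embed₂-disjoint e#f _ (inj₁ refl) (inj₂ refl) = e#f _ (inj₁ refl) (inj₂ refl)
      embed₂-disjoint e#f _ (inj₂ refl) (inj₁ refl) = e#f _ (inj₂ refl) (inj₁ refl)
      embed₂-disjoint e#f _ (inj₂ refl) (inj₂ refl) = e#f _ (inj₂ refl) (inj₂ refl)

      apart : ∀ {e f} → e ∈ reroute K taken → f ∈ kept → Disjoint e (embed₂ f)
      -- The shared vertex is an end of `f`, hence in M₂, where being available means being in
      -- `taken`.
      apart e∈ f∈ _ z∈e (inj₁ refl) = AllPairs-++-cross taken taken++kept!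
        (reroute-Available K taken e∈ z∈e)
        (∈-endpointsOf⁺ (Any.map (λ where refl → inj₁ refl) f∈)) refl
      apart e∈ f∈ _ z∈e (inj₂ refl) = AllPairs-++-cross taken taken++kept!
        (reroute-Available K taken e∈ z∈e)
        (∈-endpointsOf⁺ (Any.map (λ where refl → inj₂ refl) f∈)) refl

    -- Upper bound for an arbitrary matching of G.

    module _ (F₁-disjoint : AllPairs Disjoint F₁) (F₁-perfect : ∀ x → Matched F₁ x)
             (F₂-maximum : IsMaximumMatching (H (suc zero)) (F (suc zero)))
             (pendant : UniqueNeighbour G′ zero (suc zero)) (split : IsVirtualSplit L) where

      length≤F₁+reduced : ∀ N → IsMatching G N → ∃ λ N* → IsMatching G* N* ×
                          length N ≤ length F₁ + length N*
      length≤F₁+reduced N N-matching with classifyAll pendant N-matching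
      ... | K , #K≡#N , K-disjoint =
        reroute K taken ++ map embed₂ kept ,
        reroute++kept-IsMatching K-disjoint F₂*-match vertices! al ,
        (begin
          length N                                      ≡⟨ #K≡#N ⟨
          length K                                      ≤⟨ bound #kept exhaustion ⟩
          f + (r + p)                                   ≡⟨ cong (f +_) #N* ⟨
          f + length (reroute K taken ++ map embed₂ kept) ∎)
        where
        open ℕ.≤-Reasoning

        matched? : Decidable (Matched (F₂* L))
        matched? x = any? (λ (a , b) → x Fin.≟ a ⊎-dec x Fin.≟ b) (F₂* L)

        exposed? : Decidable (Exposed (F₂* L))
        exposed? x = ¬? (matched? x)

        -- The vertices of M₂ exposed by `F₂* L`; together with the ends of `F₂* L` they list M₂
        -- without repetition.
        es : List M₂
        es = filter exposed? (allFin _)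

        es-exposed : All (Exposed (F₂* L)) es
        es-exposed = All.all-filter exposed? (allFin _)

        es! : Unique es
        es! = Unique.filter⁺ exposed? (Unique.allFin⁺ _)

        exhaustion : length es ≤ 1 ⊎ length F₁ ≤ length L
        exhaustion = exhausted F₁-disjoint (proj₂ split) es! es-exposed

        F₂*-match : IsMatching (H₂* L) (F₂* L)
        F₂*-match = F₂*-matching (proj₁ F₂-maximum) (proj₁ split)

        vertices! : Unique (es ++ endpointsOf (F₂* L))
        vertices! = Unique.++⁺ es!
          (endpointsOf-Unique (F₂*-no-loops (proj₁ F₂-maximum) (proj₁ split)) (proj₂ F₂*-match))
          (λ (x∈es , x∈F₂*) → All.lookup es-exposed x∈es (∈-endpointsOf⁻ (F₂* L) x∈F₂*))

        cover : ∀ x → x ∈ es ++ endpointsOf (F₂* L)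
        cover x with matched? x
        ... | yes m = Any.++⁺ʳ es (∈-endpointsOf⁺ m)
        ... | no ¬m = Any.++⁺ˡ (∈-filter⁺ exposed? (∈-allFin x) ¬m)

        s = length (F₂* L)

        -- `F₁` matches every vertex of M₁, so M₁ has at most 2f vertices.
        #ends₁ : length (concatMap ends₁ K) ≤ length F₁ + length F₁
        #ends₁ = subst (length (concatMap ends₁ K) ≤_) (length-endpointsOf F₁) (Unique-length-≤
          (concatMap-ends₁-Unique K-disjoint) λ x _ → ∈-endpointsOf⁺ (F₁-perfect x))

        #ends₂ : length (concatMap ends₂ K) ≤ length es + (s + s)
        #ends₂ = subst (length (concatMap ends₂ K) ≤_)
          (trans (List.length-++ es) (cong (length es +_) (length-endpointsOf (F₂* L))))
          (Unique-length-≤ (concatMap-ends₂-Unique K-disjoint) λ x _ → cover x)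

        #edges₂ : length (concatMap edges₂ K) ≤ length (F (suc zero))
        #edges₂ = proj₂ F₂-maximum _ (concatMap-edges₂-IsMatching K-disjoint)

        crossings≤ : ∀ K → crossings K ≤ length (concatMap ends₂ K)
        crossings≤ []                  = z≤n
        crossings≤ (within₁ _ _ _ ∷ K) = crossings≤ K
        crossings≤ (bridge _ _ ∷ K)    = ℕ.m≤n⇒m≤1+n (crossings≤ K)
        crossings≤ (within₂ _ _ _ ∷ K) = ℕ.m≤n⇒m≤1+n (ℕ.m≤n⇒m≤1+n (crossings≤ K))
        crossings≤ (cross _ _ _ ∷ K)   = s≤s (crossings≤ K)
        crossings≤ (outer _ _ _ ∷ K)   = crossings≤ K

        al : Allocation (crossings K) es (F₂* L)
        -- Each crossing edge has its own end in M₂, so M₂ has enough vertices to withdraw.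
        al = allocate (crossings K) es (F₂* L) (ℕ.≤-trans (crossings≤ K) #ends₂)

        open Allocation al

        #N* : length (reroute K taken ++ map embed₂ kept) ≡ length (reroute K taken) + length kept
        #N* = trans (List.length-++ (reroute K taken))
          (cong (length (reroute K taken) +_) (List.length-map embed₂ kept))

        #F₂* : s ≡ length L + length (F (suc zero))
        #F₂* = trans (List.length-++ (map proj₁ L)) (cong (_+ _) (List.length-map proj₁ L))

        f = length F₁
        r = length (reroute K taken)
        p = length kept
        c = crossings K

        -- The hypothesis says that at most one vertex of M₂ is neither taken nor an end of a kept
        -- edge. Bounding the ends in M₁ by 2f and those in M₂ by all of M₂, the term `c` cancels
        -- from the double count and `half-≤` removes the excess of one.
        by-vertices : length es + (s + s) ≤ suc (p + p + c) → length K ≤ f + (r + p)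
        by-vertices m₂≤ = half-≤ _ _ (ℕ.+-cancelʳ-≤ c _ _ (begin
          length K + length K + c                 ≡⟨ 2*#kinds K taken #taken ⟩
          length (concatMap ends₁ K) + length (concatMap ends₂ K) + (r + r)
            ≤⟨ ℕ.+-monoˡ-≤ (r + r) (ℕ.+-mono-≤ #ends₁ (ℕ.≤-trans #ends₂ m₂≤)) ⟩
          f + f + suc (p + p + c) + (r + r)       ≡⟨ rearrange f p c r ⟩
          suc (f + (r + p) + (f + (r + p))) + c   ∎))
          where
          rearrange : ∀ f p c r → f + f + suc (p + p + c) + (r + r) ≡
                                  suc (f + (r + p) + (f + (r + p))) + c
          rearrange = solve-∀

        bound : p ≡ s ⊎ length es + (s + s) ≤ suc (p + p + c) →
                length es ≤ 1 ⊎ f ≤ length L → length K ≤ f + (r + p)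
        bound (inj₂ m₂≤) _          = by-vertices m₂≤
        -- All of `F₂* L` is kept and at most one vertex is exposed, so M₂ again has no more than
        -- one spare vertex.
        bound (inj₁ p≡s) (inj₁ e≤1) = by-vertices (subst (λ p → length es + (s + s) ≤ suc (p + p + c))
          (sym p≡s) (ℕ.+-mono-≤ e≤1 (ℕ.m≤m+n (s + s) c)))
        -- Every edge of `F₁` has become a label: of the at most 2f ends in M₁, f are paid by `F₁`
        -- and f by the virtual edges, all of which are kept; the edges inside M₂ are paid by the
        -- original matching of H₂.
        bound (inj₁ p≡s) (inj₂ f≤ℓ) = begin
          length K  ≤⟨ #kinds≤ K taken #taken ⟩
          length (concatMap ends₁ K) + length (concatMap edges₂ K) + r
            ≤⟨ ℕ.+-monoˡ-≤ r (ℕ.+-mono-≤ (ℕ.≤-trans #ends₁ (ℕ.+-monoʳ-≤ f f≤ℓ)) #edges₂) ⟩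
          f + length L + length (F (suc zero)) + r  ≡⟨ rearrange f (length L) _ r ⟩
          f + (r + (length L + length (F (suc zero))))  ≡⟨ cong (λ z → f + (r + z)) (trans p≡s #F₂*) ⟨
          f + (r + p)                               ∎
          where
          rearrange : ∀ f l g r → f + l + g + r ≡ f + (r + (l + g))
          rearrange = solve-∀

    -- Post-processing yields a matching of G.

    module _ (v₁v₂ : Adj G′ zero (suc zero)) (F₁-IsMatching : IsMatching (H zero) F₁)
             (H₂-matching : IsMatching (H (suc zero)) (F (suc zero))) (reachable : Reachable L)
             {F* : List (Edge Vertex*)} (F*-IsMatching : IsMatching G* F*) where

      unsplit-cases : ∀ (s : Labelled) → let (x₂ , y₂) , (x₁ , y₁) = s in
        virtualEdge L s ∈ₑ F* ×
          unsplit L F* s ≡ (inM₁ L x₁ , inM₂ L y₂) ∷ (inM₂ L x₂ , inM₁ L y₁) ∷ []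
        ⊎ unsplit L F* s ≡ (inM₁ L x₁ , inM₁ L y₁) ∷ []
      unsplit-cases s with EdgeDec._∈ₑ?_ (Triple._≟ᵥ_ (reduced L)) (virtualEdge L s) F*
      ... | yes s∈ = inj₁ (s∈ , refl)
      ... | no  _  = inj₂ refl

      -- Bounds the vertices covered by `unsplit`. Ends in M₂ count only if the virtual edge lies in
      -- `F*`; otherwise real edges of `F*` are free to use them.
      data Touches (s : Labelled) : Vertex → Set where
        label   : ∀ {x} → Incident x (proj₂ s) → Touches s (zero , x)
        virtual : ∀ {x} → Incident x (proj₁ s) → virtualEdge L s ∈ₑ F* → Touches s (suc zero , x)

      unsplit-Touches : ∀ s {e z} → e ∈ unsplit L F* s → Incident z e → Touches s z
      unsplit-Touches s {e} {z} e∈ z∈e with unsplit-cases s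
      ... | inj₂ eq        = single (subst (e ∈_) eq e∈) z∈e
        where
        single : e ∈ (inM₁ L _ , inM₁ L _) ∷ [] → Incident z e → Touches s z
        single (here refl) (inj₁ refl) = label (inj₁ refl)
        single (here refl) (inj₂ refl) = label (inj₂ refl)
      ... | inj₁ (s∈ , eq) = double (subst (e ∈_) eq e∈) z∈e
        where
        double : e ∈ (inM₁ L _ , inM₂ L _) ∷ (inM₂ L _ , inM₁ L _) ∷ [] → Incident z e → Touches s z
        double (here refl) (inj₁ refl)         = label (inj₁ refl)
        double (here refl) (inj₂ refl)         = virtual (inj₂ refl) s∈
        double (there (here refl)) (inj₁ refl) = virtual (inj₁ refl) s∈
        double (there (here refl)) (inj₂ refl) = label (inj₂ refl)

      ∈ₑF₁⇒Adj : ∀ {x y} → (x , y) ∈ₑ F₁ → Adj (H zero) x y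
      ∈ₑF₁⇒Adj e∈ with find e∈
      ... | _ , f∈ , inj₁ (refl , refl) = All.lookup (proj₁ F₁-IsMatching) f∈
      ... | _ , f∈ , inj₂ (refl , refl) = symm (H zero) (All.lookup (proj₁ F₁-IsMatching) f∈)

      unsplit-IsEdge : ∀ s → proj₂ s ∈ₑ F₁ → All (IsEdge G) (unsplit L F* s)
      unsplit-IsEdge s l∈F₁ with unsplit-cases s
      ... | inj₁ (_ , eq) = subst (All (IsEdge G)) (sym eq) (across v₁v₂ ∷ across (symm G′ v₁v₂) ∷ [])
      ... | inj₂ eq       = subst (All (IsEdge G)) (sym eq) (inside (∈ₑF₁⇒Adj l∈F₁) ∷ [])

      -- The two replacement edges could meet only if the label or the virtual edge were a loop.
      unsplit-disjoint : ∀ s → proj₁ (proj₁ s) ≢ proj₂ (proj₁ s) → proj₂ s ∈ₑ F₁ →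
                         AllPairs Disjoint (unsplit L F* s)
      unsplit-disjoint s@((x₂ , y₂) , (x₁ , y₁)) x₂≢y₂ l∈F₁ with unsplit-cases s
      ... | inj₂ eq       = subst (AllPairs Disjoint) (sym eq) ([] ∷ [])
      ... | inj₁ (_ , eq) = subst (AllPairs Disjoint) (sym eq) ((apart ∷ []) ∷ [] ∷ [])
        where
        apart : Disjoint (inM₁ L x₁ , inM₂ L y₂) (inM₂ L x₂ , inM₁ L y₁)
        apart _ (inj₁ refl) (inj₂ refl) = irrefl (H zero) refl (∈ₑF₁⇒Adj l∈F₁)
        apart _ (inj₂ refl) (inj₁ refl) = x₂≢y₂ refl

      -- The only adjacencies of the reduced graph that G may lack are the ones added to H₂, and
      -- each of these is a virtual edge.
      embed-IsEdge : ∀ u v → Adj G* u v → (u , v) ∉ₑ map (virtualEdge L) L →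
                     Adj G (embed L u) (embed L v)
      embed-IsEdge (zero , x)  (zero , y)  (inside (inj₁ xy))       _   = inside xy
      embed-IsEdge (zero , x)  (zero , y)  (inside (inj₂ (_ , xy))) ¬xy =
        ⊥-elim (¬xy (Any.map⁺ (Any.map (λ {s} → embed-≈ s) (Any.map⁻ xy))))
        where
        embed-≈ : ∀ s → (x , y) ≈ₑ proj₁ s → ((zero , x) , (zero , y)) ≈ₑ virtualEdge L s
        embed-≈ s (inj₁ (refl , refl)) = inj₁ (refl , refl)
        embed-≈ s (inj₂ (refl , refl)) = inj₂ (refl , refl)
      embed-IsEdge (suc i , x) (suc _ , y) (inside xy) _ = inside xy
      embed-IsEdge (_ , x)     (_ , y)     (across ij) _ = across ij

      embedEdge-Incident : ∀ e {z} → Incident z (embedEdge L e) →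
                           ∃ λ w → z ≡ embed L w × Incident w e
      embedEdge-Incident (u , v) (inj₁ z≡) = u , z≡ , inj₁ refl
      embedEdge-Incident (u , v) (inj₂ z≡) = v , z≡ , inj₂ refl

      embed-injective : ∀ {u v} → embed L u ≡ embed L v → u ≡ v
      embed-injective refl = refl

      embedEdge-disjoint : ∀ {e f} → Disjoint e f → Disjoint (embedEdge L e) (embedEdge L f)
      embedEdge-disjoint {e} {f} e#f z z∈e z∈f
        with embedEdge-Incident e z∈e | embedEdge-Incident f z∈f
      ... | u , refl , u∈e | v , eq , v∈f with refl ← embed-injective {u} {v} eq = e#f u u∈e v∈f

      virtualEdge-Incident : ∀ s {x} → Incident x (proj₁ s) → Incident (zero , x) (virtualEdge L s)
      virtualEdge-Incident s (inj₁ refl) = inj₁ refl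
      virtualEdge-Incident s (inj₂ refl) = inj₂ refl

      inM₁-Incident : ∀ {e z} → Incident z (inM₁ L (proj₁ e) , inM₁ L (proj₂ e)) →
                      ∃ λ x → z ≡ (zero , x) × Incident x e
      inM₁-Incident (inj₁ refl) = _ , refl , inj₁ refl
      inM₁-Incident (inj₂ refl) = _ , refl , inj₂ refl

      labels! : AllPairs (Disjoint on proj₂) L
      labels! = labels-disjoint (proj₂ F₁-IsMatching) reachable

      virtuals! : AllPairs (Disjoint on proj₁) L
      virtuals! = AllPairs.map⁻ (AllPairs-++⁻ˡ (map proj₁ L) (F₂*-disjoint H₂-matching reachable))

      real : List (Edge Vertex*)
      real = filter (λ e → ¬? (virtual? L e)) F*

      unlabelled : List (Edge M₁)
      unlabelled = filter (λ e → ¬? (label? L e)) F₁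

      real∈ : ∀ {e} → e ∈ real → e ∈ F* × e ∉ₑ map (virtualEdge L) L
      real∈ = ∈-filter⁻ (λ e → ¬? (virtual? L e))

      unlabelled∈ : ∀ {e} → e ∈ unlabelled → e ∈ F₁ × e ∉ₑ map proj₂ L
      unlabelled∈ = ∈-filter⁻ (λ e → ¬? (label? L e))

      -- Two members of a matching are equal or disjoint, and equality would put `e` among the
      -- excluded edges. Used in `F*` to separate real from virtual edges and in `F₁` to separate
      -- unlabelled edges from labels.
      ∉ₑ⇒Disjoint : ∀ {V A : Set} {M : List (Edge V)} (f : A → Edge V) {xs e x} → AllPairs Disjoint M →
                    e ∈ M → e ∉ₑ map f xs → x ∈ xs → f x ∈ₑ M → Disjoint e (f x)
      ∉ₑ⇒Disjoint f M! e∈ e∉ x∈ fx∈ with find fx∈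
      ... | g , g∈ , fx≈g with AllPairs-lookup Disjoint-sym M! e∈ g∈
      ... | inj₁ refl = ⊥-elim (e∉ (Any.map⁺ (Any.map (λ where refl → ≈ₑ-sym fx≈g) x∈)))
      ... | inj₂ e#g  = λ z z∈e z∈fx → e#g z z∈e (≈ₑ-Incident fx≈g z∈fx)

      Touches-disjoint : ∀ {s t} → Disjoint (proj₁ s) (proj₁ t) → Disjoint (proj₂ s) (proj₂ t) →
                         ∀ {z} → Touches s z → ¬ Touches t z
      Touches-disjoint v# l# (label x∈s)     (label x∈t)     = l# _ x∈s x∈t
      Touches-disjoint v# l# (virtual x∈s _) (virtual x∈t _) = v# _ x∈s x∈t

      -- A real edge lives outside M₁, so it could only meet an end of a virtual edge of `F*`; but
      -- both edges belong to the matching `F*`.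
      real-Touches : ∀ {e s} → e ∈ real → s ∈ L → ∀ {z} → Incident z (embedEdge L e) → ¬ Touches s z
      real-Touches {e} e∈ s∈ z∈e t with embedEdge-Incident e z∈e
      real-Touches {e} {s} e∈ s∈ z∈e (virtual x∈s s∈F*) | (zero , x) , refl , w∈e =
        ∉ₑ⇒Disjoint (virtualEdge L) (proj₂ F*-IsMatching) (proj₁ (real∈ e∈)) (proj₂ (real∈ e∈))
          s∈ s∈F* _ w∈e (virtualEdge-Incident s x∈s)

      unlabelled-Touches : ∀ {e s} → e ∈ unlabelled → s ∈ L →
                           ∀ {x} → Incident x e → ¬ Touches s (zero , x)
      unlabelled-Touches e∈ s∈ x∈e (label x∈s) =
        ∉ₑ⇒Disjoint proj₂ (proj₂ F₁-IsMatching) (proj₁ (unlabelled∈ e∈)) (proj₂ (unlabelled∈ e∈))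
          s∈ (All.lookup (labels∈F₁ reachable) s∈) _ x∈e x∈s

      real-IsMatching : IsMatching G (map (embedEdge L) real)
      real-IsMatching =
        All.map⁺ (All.tabulate λ {e} e∈ → embed-IsEdge (proj₁ e) (proj₂ e)
          (All.lookup (proj₁ F*-IsMatching) (proj₁ (real∈ e∈))) (proj₂ (real∈ e∈))) ,
        AllPairs.map⁺ (AllPairs.map embedEdge-disjoint
          (AllPairs.filter⁺ (λ e → ¬? (virtual? L e)) (proj₂ F*-IsMatching)))

      unsplit-IsMatching : IsMatching G (concatMap (unsplit L F*) L)
      unsplit-IsMatching =
        All.concat⁺ (All.map⁺ (All.map (unsplit-IsEdge _) (labels∈F₁ reachable))) ,
        concatMap-AllPairs (unsplit L F*)
          (λ s t (v# , l#) e f e∈ f∈ z z∈e z∈f →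
            Touches-disjoint v# l# (unsplit-Touches s e∈ z∈e) (unsplit-Touches t f∈ z∈f))
          (All.zipWith (λ (x≢y , l∈) → unsplit-disjoint _ x≢y l∈)
            (All.map⁻ (All.++⁻ˡ (map proj₁ L) (F₂*-no-loops H₂-matching reachable)) , labels∈F₁ reachable))
          (AllPairs.zip (virtuals! , labels!))

      unlabelled-IsMatching : IsMatching G (map (λ (x , y) → inM₁ L x , inM₁ L y) unlabelled)
      unlabelled-IsMatching =
        All.map⁺ (All.map inside (All.filter⁺ (λ e → ¬? (label? L e)) (proj₁ F₁-IsMatching))) ,
        AllPairs.map⁺ (AllPairs.map inM₁-disjoint
          (AllPairs.filter⁺ (λ e → ¬? (label? L e)) (proj₂ F₁-IsMatching)))
        where
        inM₁-disjoint : ∀ {e f : Edge M₁} → Disjoint e f →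
          Disjoint (inM₁ L (proj₁ e) , inM₁ L (proj₂ e)) (inM₁ L (proj₁ f) , inM₁ L (proj₂ f))
        inM₁-disjoint e#f z z∈e z∈f with inM₁-Incident z∈e | inM₁-Incident z∈f
        ... | x , refl , x∈e | _ , refl , x∈f = e#f x x∈e x∈f

      postProcess-IsMatching : IsMatching G (postProcess L F*)
      postProcess-IsMatching =
        All.++⁺ (proj₁ real-IsMatching)
          (All.++⁺ (proj₁ unsplit-IsMatching) (proj₁ unlabelled-IsMatching)) ,
        AllPairs.++⁺ (proj₂ real-IsMatching)
          (AllPairs.++⁺ (proj₂ unsplit-IsMatching) (proj₂ unlabelled-IsMatching)
            (All.concat⁺ (All.map⁺ (All.tabulate λ {s} s∈ → All.tabulate λ e∈ →
              All.map⁺ (All.tabulate λ f∈ → unsplit#unlabelled s∈ e∈ f∈)))))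
          (All.map⁺ (All.tabulate λ e∈ →
            All.++⁺ (All.concat⁺ (All.map⁺ (All.tabulate λ s∈ → All.tabulate λ f∈ → real#unsplit e∈ s∈ f∈)))
                    (All.map⁺ (All.tabulate λ f∈ → real#unlabelled))))
        where
        unsplit#unlabelled : ∀ {s e f} → s ∈ L → e ∈ unsplit L F* s → f ∈ unlabelled →
                             Disjoint e (inM₁ L (proj₁ f) , inM₁ L (proj₂ f))
        unsplit#unlabelled s∈ e∈ f∈ z z∈e z∈f with inM₁-Incident z∈f
        ... | x , refl , x∈f = unlabelled-Touches f∈ s∈ x∈f (unsplit-Touches _ e∈ z∈e)

        real#unsplit : ∀ {s e f} → e ∈ real → s ∈ L → f ∈ unsplit L F* s → Disjoint (embedEdge L e) f
        real#unsplit e∈ s∈ f∈ z z∈e z∈f = real-Touches e∈ s∈ z∈e (unsplit-Touches _ f∈ z∈f)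

        real#unlabelled : ∀ {e} {f : Edge M₁} →
                          Disjoint (embedEdge L e) (inM₁ L (proj₁ f) , inM₁ L (proj₂ f))
        -- Embedded vertices have a successor as module index, so none lies in M₁.
        real#unlabelled {e} z z∈e z∈f with embedEdge-Incident e z∈e | inM₁-Incident z∈f
        ... | _ , refl , _ | _ , () , _

      -- The size of the post-processed matching.

      used? : Decidable (λ s → virtualEdge L s ∈ₑ F*)
      used? s = EdgeDec._∈ₑ?_ (Triple._≟ᵥ_ (reduced L)) (virtualEdge L s) F*

      length-unsplit : ∀ S → length (concatMap (unsplit L F*) S) ≡ length S + length (filter used? S)
      length-unsplit []      = refl
      length-unsplit (s ∷ S) with used? s
      ... | yes _ = trans (cong (2 +_) (length-unsplit S)) (cong suc (sym (ℕ.+-suc _ _)))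
      ... | no _  = cong suc (length-unsplit S)

      -- `F₁` is split into labels and other edges, `F*` into virtual and real ones. Unlabelled and
      -- real edges survive unchanged, so only labels and virtual edges must be compared with what
      -- `unsplit` produces.
      length-postProcess : length F₁ + length F* ≤ length (postProcess L F*)
      length-postProcess = begin
        length F₁ + length F*
          ≡⟨ cong₂ _+_ (length-filter-¬ (label? L) F₁) (length-filter-¬ (virtual? L) F*) ⟨
        length unlabelled + length (filter (label? L) F₁)
          + (length real + length (filter (virtual? L) F*))
          ≤⟨ ℕ.+-mono-≤ (ℕ.+-monoʳ-≤ (length unlabelled) #labelled)
                        (ℕ.+-monoʳ-≤ (length real) #virtual) ⟩
        length unlabelled + length L + (length real + length (filter used? L))
          ≡⟨ rearrange (length unlabelled) (length L) (length real) _ ⟩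
        length real + (length L + length (filter used? L) + length unlabelled)
          ≡⟨ #post ⟨
        length (postProcess L F*) ∎
        where
        open ℕ.≤-Reasoning

        rearrange : ∀ u l r v → u + l + (r + v) ≡ r + (l + v + u)
        rearrange = solve-∀

        #post : length (postProcess L F*) ≡
                length real + (length L + length (filter used? L) + length unlabelled)
        #post = trans (List.length-++ (map (embedEdge L) real)) (cong₂ _+_
          (List.length-map (embedEdge L) real)
          (trans (List.length-++ (concatMap (unsplit L F*) L))
            (cong₂ _+_ (length-unsplit L) (List.length-map _ unlabelled))))

        #labelled : length (filter (label? L) F₁) ≤ length L
        #labelled = subst (length (filter (label? L) F₁) ≤_) (List.length-map proj₂ L)
          (pigeonhole
            (AllPairs.map Disjoint-≈ₑ (AllPairs.filter⁺ (label? L) (proj₂ F₁-IsMatching)))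
            (All.all-filter (label? L) F₁))

        -- Disjoint edges of `F*` cannot equal the same virtual edge, and a virtual edge met in this
        -- way is itself in `F*`.
        #virtual : length (filter (virtual? L) F*) ≤ length (filter used? L)
        #virtual = pigeonhole
          (AllPairs.map (λ e#f s → Disjoint-≈ₑ e#f (virtualEdge L s))
            (AllPairs.filter⁺ (virtual? L) (proj₂ F*-IsMatching)))
          (All.tabulate λ {e} e∈ → used (∈-filter⁻ (virtual? L) e∈))
          where
          used : ∀ {e} → e ∈ F* × e ∈ₑ map (virtualEdge L) L →
                 Any (λ s → e ≈ₑ virtualEdge L s) (filter used? L)
          used (e∈F* , e∈V) with find (Any.map⁻ e∈V)
          ... | s , s∈L , e≈s = Any.map (λ where refl → e≈s)
            (∈-filter⁺ used? s∈L (Any.map (λ where refl → ≈ₑ-sym e≈s) e∈F*))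

-- Maximality of the post-processed matching.

lemma9 : ∀ (n : ℕ) (I : Triple (2 + n)) →
    let open Triple I
        open Split I in
    IsModuleMatching I →
    UniqueNeighbour G′ zero (suc zero) →
    (∀ i x y → Adj (H i) x y ⇔ (x , y) ∈ₑ F i) →
    (∀ x → Matched (F zero) x) →
    ∀ (L : List Labelled) → IsVirtualSplit L →
    ∀ (F* : List (Edge (Triple.Vertex (reduced L)))) →
    IsMaximumMatching (Triple.G (reduced L)) F* →
    IsMaximumMatching G (postProcess L F*)
lemma9 n I maximum pendant _ F₁-perfect L split F* (F*-matching , F*-max) =
  postProcess-IsMatching I L (proj₁ pendant) F₁-matching F₂-matching (proj₁ split) F*-matching ,
  λ N N-matching →
    let N* , N*-matching , #N≤ = length≤F₁+reduced I L (proj₂ F₁-matching) F₁-perfect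
                                   (maximum (suc zero)) pendant split N N-matching
    -- The chain is |N| ≤ f + |N*| ≤ f + |F*| ≤ |F|, the middle step by maximality of `F*`.
    in ℕ.≤-trans #N≤ (ℕ.≤-trans (ℕ.+-monoʳ-≤ _ (F*-max N* N*-matching))
         (length-postProcess I L (proj₁ pendant) F₁-matching F₂-matching (proj₁ split) F*-matching))
  where
  F₁-matching = proj₁ (maximum zero)
  F₂-matching = proj₁ (maximum (suc zero))
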